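{- Let $(F_n)_{n\in\mathbb{N}_0}$ be the Fibonacci numbers, defined by $F_0=1$, $F_1=1$ and $F_n=F_{n-1}+F_{n-2}$ for every integer $n\geq 2$. Then $h(\{F_n \colon n \in \mathbb{N}_0\}^2) = \infty$.
   Context: $\mathbb{N}_0=\{0,1,2,\dots\}$. For a discrete set $S\subseteq\mathbb{R}^2$, a convex polygon $P$ with all vertices in $S$ is empty in $S$ if $P$ (including its boundary, in particular the interiors of its edges) contains no points of $S$ other than its vertices. $h(S)$ denotes the maximum number of vertices of an empty polygon in $S$, with $h(S)=\infty$ if there are empty polygons in $S$ with arbitrarily many vertices. For $A\subseteq\mathbb{R}$, $A^2=A\times A$. -}

module Defs where

open import Data.Integer.Base using (+_)
open import Data.Nat.Base as ℕ using (ℕ; suc; _⊔_)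
open import Data.Nat.Properties as ℕₚ using (m≤m⊔n; m≤n⊔m; m⊔n≤o⇒m≤o; m⊔n≤o⇒n≤o)
open import Data.Product.Base using (_×_; _,_; ∃; ∃-syntax; proj₁; proj₂)
open import Data.Rational.Base as ℚ using (ℚ; 0ℚ; 1ℚ; ½; ∣_∣; 1/_; positive; nonNegative)
open import Data.Rational.Properties as ℚₚ
open import Data.Rational.Solver using (module +-*-Solver)
open import Data.Vec.Functional using (Vector; foldr; removeAt)
open import Level using (0ℓ)
open import Relation.Binary.PropositionalEquality
open import Relation.Unary using (Pred; _∈_; _∉_)

------------------------------------------------------------------------
-- Real numbers as Cauchy sequences of rationals

IsCauchy : (ℕ → ℚ) → Set
IsCauchy s = ∀ ε → 0ℚ ℚ.< ε →
  ∃[ N ] (∀ m n → N ℕ.≤ m → N ℕ.≤ n → ∣ s m ℚ.- s n ∣ ℚ.< ε)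

private

  0<1ℚ : 0ℚ ℚ.< 1ℚ
  0<1ℚ = positive⁻¹ 1ℚ

  half-pos : ∀ {ε} → 0ℚ ℚ.< ε → 0ℚ ℚ.< ½ ℚ.* ε
  half-pos {ε} 0<ε =
    positive⁻¹ (½ ℚ.* ε) {{pos*pos⇒pos ½ ε {{positive 0<ε}}}}

  half+half : ∀ ε → ½ ℚ.* ε ℚ.+ ½ ℚ.* ε ≡ ε
  half+half ε = trans (sym (*-distribʳ-+ ε ½ ½)) (*-identityˡ ε)

  eventually-bounded : ∀ s → IsCauchy s →
    ∃[ B ] 0ℚ ℚ.< B × ∃[ N ] (∀ n → N ℕ.≤ n → ∣ s n ∣ ℚ.< B)
  eventually-bounded s c with c 1ℚ 0<1ℚ
  ... | N , near = B , 0<B , N , bound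
    where
    B = 1ℚ ℚ.+ ∣ s N ∣

    0<B : 0ℚ ℚ.< B
    0<B = +-mono-<-≤ 0<1ℚ (0≤∣p∣ (s N))

    split : ∀ x y → x ≡ (x ℚ.- y) ℚ.+ y
    split = solve 2 (λ x y → x := (x :- y) :+ y) refl
      where open +-*-Solver

    bound : ∀ n → N ℕ.≤ n → ∣ s n ∣ ℚ.< B
    bound n N≤n = begin-strict
      ∣ s n ∣                       ≡⟨ cong ∣_∣ (split (s n) (s N)) ⟩
      ∣ (s n ℚ.- s N) ℚ.+ s N ∣     ≤⟨ ∣p+q∣≤∣p∣+∣q∣ (s n ℚ.- s N) (s N) ⟩
      ∣ s n ℚ.- s N ∣ ℚ.+ ∣ s N ∣   <⟨ +-monoˡ-< ∣ s N ∣ (near n N N≤n ℕₚ.≤-refl) ⟩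
      B                             ∎
      where open ℚₚ.≤-Reasoning

abstract

  const-cauchy : ∀ q → IsCauchy (λ _ → q)
  const-cauchy q ε 0<ε = 0 , λ _ _ _ _ →
    subst (λ d → ∣ d ∣ ℚ.< ε) (sym (+-inverseʳ q)) 0<ε

  +-cauchy : ∀ s t → IsCauchy s → IsCauchy t → IsCauchy (λ n → s n ℚ.+ t n)
  +-cauchy s t cs ct ε 0<ε
    with cs (½ ℚ.* ε) (half-pos 0<ε) | ct (½ ℚ.* ε) (half-pos 0<ε)
  ... | M , p | N , q = M ⊔ N , λ m n l k → begin-strict
    ∣ (s m ℚ.+ t m) ℚ.- (s n ℚ.+ t n) ∣
      ≡⟨ cong ∣_∣ (regroup (s m) (t m) (s n) (t n)) ⟩
    ∣ (s m ℚ.- s n) ℚ.+ (t m ℚ.- t n) ∣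
      ≤⟨ ∣p+q∣≤∣p∣+∣q∣ (s m ℚ.- s n) (t m ℚ.- t n) ⟩
    ∣ s m ℚ.- s n ∣ ℚ.+ ∣ t m ℚ.- t n ∣
      <⟨ +-mono-<
           (p m n (ℕₚ.≤-trans (m≤m⊔n M N) l) (ℕₚ.≤-trans (m≤m⊔n M N) k))
           (q m n (ℕₚ.≤-trans (m≤n⊔m M N) l) (ℕₚ.≤-trans (m≤n⊔m M N) k)) ⟩
    ½ ℚ.* ε ℚ.+ ½ ℚ.* ε
      ≡⟨ half+half ε ⟩
    ε ∎
    where
    open ℚₚ.≤-Reasoning

    regroup : ∀ a b c d → (a ℚ.+ b) ℚ.- (c ℚ.+ d) ≡ (a ℚ.- c) ℚ.+ (b ℚ.- d)
    regroup = solve 4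
      (λ a b c d → (a :+ b) :- (c :+ d) := (a :- c) :+ (b :- d)) refl
      where open +-*-Solver

private

  product-close : ∀ {A B δ} a b c d → 0ℚ ℚ.< A → 0ℚ ℚ.< B →
    ∣ a ∣ ℚ.< A → ∣ d ∣ ℚ.< B → ∣ a ℚ.- c ∣ ℚ.< δ → ∣ b ℚ.- d ∣ ℚ.< δ →
    ∣ a ℚ.* b ℚ.- c ℚ.* d ∣ ℚ.< (A ℚ.+ B) ℚ.* δ
  product-close {A} {B} {δ} a b c d 0<A 0<B a<A d<B ac bd = begin-strict
    ∣ a ℚ.* b ℚ.- c ℚ.* d ∣
      ≡⟨ cong ∣_∣ (regroup a b c d) ⟩
    ∣ a ℚ.* (b ℚ.- d) ℚ.+ d ℚ.* (a ℚ.- c) ∣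
      ≤⟨ ∣p+q∣≤∣p∣+∣q∣ (a ℚ.* (b ℚ.- d)) (d ℚ.* (a ℚ.- c)) ⟩
    ∣ a ℚ.* (b ℚ.- d) ∣ ℚ.+ ∣ d ℚ.* (a ℚ.- c) ∣
      <⟨ +-mono-< (scale a (b ℚ.- d) 0<A a<A bd) (scale d (a ℚ.- c) 0<B d<B ac) ⟩
    A ℚ.* δ ℚ.+ B ℚ.* δ
      ≡⟨ *-distribʳ-+ δ A B ⟨
    (A ℚ.+ B) ℚ.* δ ∎
    where
    open ℚₚ.≤-Reasoning

    regroup : ∀ a b c d →
      a ℚ.* b ℚ.- c ℚ.* d ≡ a ℚ.* (b ℚ.- d) ℚ.+ d ℚ.* (a ℚ.- c)
    regroup = solve 4
      (λ a b c d → a :* b :- c :* d := a :* (b :- d) :+ d :* (a :- c)) refl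
      where open +-*-Solver

    scale : ∀ {C} x y → 0ℚ ℚ.< C → ∣ x ∣ ℚ.< C → ∣ y ∣ ℚ.< δ →
            ∣ x ℚ.* y ∣ ℚ.< C ℚ.* δ
    scale {C} x y 0<C x<C y<δ = begin-strict
      ∣ x ℚ.* y ∣      ≡⟨ ∣p*q∣≡∣p∣*∣q∣ x y ⟩
      ∣ x ∣ ℚ.* ∣ y ∣  ≤⟨ *-monoʳ-≤-nonNeg ∣ y ∣ {{nonNegative (0≤∣p∣ y)}} (<⇒≤ x<C) ⟩
      C ℚ.* ∣ y ∣      <⟨ *-monoʳ-<-pos C {{positive 0<C}} y<δ ⟩
      C ℚ.* δ          ∎

  divide : ∀ K ε → 0ℚ ℚ.< K → 0ℚ ℚ.< ε → ∃[ δ ] 0ℚ ℚ.< δ × K ℚ.* δ ≡ ε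
  divide K ε 0<K 0<ε = 1/ K ℚ.* ε , 0<δ , K*δ≡ε
    where
    instance
      K-pos : ℚ.Positive K
      K-pos = positive 0<K

      K-nonZero : ℚ.NonZero K
      K-nonZero = pos⇒nonZero K

    0<δ : 0ℚ ℚ.< 1/ K ℚ.* ε
    0<δ = positive⁻¹ (1/ K ℚ.* ε)
      {{pos*pos⇒pos (1/ K) {{1/pos⇒pos K}} ε {{positive 0<ε}}}}

    K*δ≡ε : K ℚ.* (1/ K ℚ.* ε) ≡ ε
    K*δ≡ε = trans (sym (*-assoc K (1/ K) ε))
                  (trans (cong (ℚ._* ε) (*-inverseʳ K)) (*-identityˡ ε))

  product-cauchy : ∀ s t → IsCauchy s → IsCauchy t → ∀ {A B δ ε N₁ N₂} →
    0ℚ ℚ.< A → (∀ n → N₁ ℕ.≤ n → ∣ s n ∣ ℚ.< A) →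
    0ℚ ℚ.< B → (∀ n → N₂ ℕ.≤ n → ∣ t n ∣ ℚ.< B) →
    0ℚ ℚ.< δ → (A ℚ.+ B) ℚ.* δ ≡ ε →
    ∃[ N ] (∀ m n → N ℕ.≤ m → N ℕ.≤ n → ∣ s m ℚ.* t m ℚ.- s n ℚ.* t n ∣ ℚ.< ε)
  product-cauchy s t cs ct {δ = δ} {N₁ = N₁} {N₂} 0<A s<A 0<B t<B 0<δ refl
    with cs δ 0<δ | ct δ 0<δ
  ... | M₁ , p | M₂ , q = (N₁ ⊔ N₂) ⊔ (M₁ ⊔ M₂) , λ m n l k →
    product-close (s m) (t m) (s n) (t n) 0<A 0<B
      (s<A m (m⊔n≤o⇒m≤o N₁ N₂ (m⊔n≤o⇒m≤o (N₁ ⊔ N₂) (M₁ ⊔ M₂) l)))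
      (t<B n (m⊔n≤o⇒n≤o N₁ N₂ (m⊔n≤o⇒m≤o (N₁ ⊔ N₂) (M₁ ⊔ M₂) k)))
      (p m n (m⊔n≤o⇒m≤o M₁ M₂ (m⊔n≤o⇒n≤o (N₁ ⊔ N₂) (M₁ ⊔ M₂) l))
             (m⊔n≤o⇒m≤o M₁ M₂ (m⊔n≤o⇒n≤o (N₁ ⊔ N₂) (M₁ ⊔ M₂) k)))
      (q m n (m⊔n≤o⇒n≤o M₁ M₂ (m⊔n≤o⇒n≤o (N₁ ⊔ N₂) (M₁ ⊔ M₂) l))
             (m⊔n≤o⇒n≤o M₁ M₂ (m⊔n≤o⇒n≤o (N₁ ⊔ N₂) (M₁ ⊔ M₂) k)))

abstract

  *-cauchy : ∀ s t → IsCauchy s → IsCauchy t → IsCauchy (λ n → s n ℚ.* t n)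
  *-cauchy s t cs ct ε 0<ε =
    let A , 0<A , _ , s<A = eventually-bounded s cs
        B , 0<B , _ , t<B = eventually-bounded t ct
        _ , 0<δ , K*δ≡ε   = divide (A ℚ.+ B) ε (+-mono-< 0<A 0<B) 0<ε
    in product-cauchy s t cs ct 0<A s<A 0<B t<B 0<δ K*δ≡ε

-- Distinct Cauchy sequences may name the same real number: equality of
-- reals is _≈_ below, not _≡_.

record ℝ : Set where
  constructor real
  field
    seq    : ℕ → ℚ
    cauchy : IsCauchy seq

open ℝ public

infix  4 _≈_ _≤_
infixl 6 _+_
infixl 7 _*_

_≈_ : ℝ → ℝ → Set
x ≈ y = ∀ ε → 0ℚ ℚ.< ε → ∃[ N ] (∀ n → N ℕ.≤ n → ∣ seq x n ℚ.- seq y n ∣ ℚ.< ε)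

_≤_ : ℝ → ℝ → Set
x ≤ y = ∀ ε → 0ℚ ℚ.< ε → ∃[ N ] (∀ n → N ℕ.≤ n → seq x n ℚ.- seq y n ℚ.< ε)

fromℚ : ℚ → ℝ
fromℚ q = real (λ _ → q) (const-cauchy q)

fromℕ : ℕ → ℝ
fromℕ n = fromℚ (+ n ℚ./ 1)

0ℝ 1ℝ : ℝ
0ℝ = fromℚ 0ℚ
1ℝ = fromℚ 1ℚ

_+_ : ℝ → ℝ → ℝ
x + y = real (λ n → seq x n ℚ.+ seq y n) (+-cauchy (seq x) (seq y) (cauchy x) (cauchy y))

_*_ : ℝ → ℝ → ℝ
x * y = real (λ n → seq x n ℚ.* seq y n) (*-cauchy (seq x) (seq y) (cauchy x) (cauchy y))

∑ : ∀ {n} → Vector ℝ n → ℝ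
∑ = foldr _+_ 0ℝ

------------------------------------------------------------------------
-- Convex polygons in the plane

ℝ² : Set
ℝ² = ℝ × ℝ

infix 4 _≈²_

_≈²_ : ℝ² → ℝ² → Set
(x , y) ≈² (x′ , y′) = x ≈ x′ × y ≈ y′

-- The convex hull of a finite family of points: all its convex combinations.

conv : ∀ {n} → Vector ℝ² n → Pred ℝ² 0ℓ
conv {n} v p = ∃ λ (w : Vector ℝ n) →
  (∀ i → 0ℝ ≤ w i) ×
  ∑ w ≈ 1ℝ ×
  (∑ (λ i → w i * proj₁ (v i)) , ∑ (λ i → w i * proj₂ (v i))) ≈² p

-- A convex polygon with m + 3 vertices is the convex hull of m + 3 points
-- none of which lies in the convex hull of the others.  The vertices are
-- not required to be listed in cyclic order.

record ConvexPolygon (m : ℕ) : Set where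
  field
    vertex         : Vector ℝ² (3 ℕ.+ m)
    convexPosition : ∀ i → vertex i ∉ conv (removeAt vertex i)

  region : Pred ℝ² 0ℓ
  region = conv vertex

open ConvexPolygon public

record IsEmptyIn (S : Pred ℝ² 0ℓ) {m : ℕ} (P : ConvexPolygon m) : Set where
  field
    vertices∈S : ∀ i → vertex P i ∈ S
    empty      : ∀ p → p ∈ S → p ∈ region P → ∃[ i ] p ≈² vertex P i

h_≡∞ : Pred ℝ² 0ℓ → Set
h S ≡∞ = ∀ k → ∃[ m ] k ℕ.≤ 3 ℕ.+ m × ∃ λ (P : ConvexPolygon m) → IsEmptyIn S P

infixl 10 _²

_² : Pred ℝ 0ℓ → Pred ℝ² 0ℓ
(A ²) (x , y) = x ∈ A × y ∈ A

------------------------------------------------------------------------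
-- Fibonacci numbers

F : ℕ → ℕ
F 0             = 1
F 1             = 1
F (suc (suc n)) = F (suc n) ℕ.+ F n

FibonacciSet : Pred ℝ 0ℓ
FibonacciSet x = ∃[ n ] x ≈ fromℕ (F n)

{-# OPTIONS --safe #-}

-- The points V i = (F 2i , F (2i + 1)) lie on one branch of the hyperbola
-- x² + xy − y² = 1, so any number of them are in convex position: the tangent
-- at each one separates it from the others.  The branch is asymptotic to the line
-- y = φx, so their hull is very thin: apart from V 0 = (1 , 1) it lies strictly
-- above the diagonal, hence above all (F a , F b) with b ≤ a, and it lies below the
-- line y = φx, hence below all (F a , F b) with b ≥ a + 2 or with a odd and
-- b = a + 1.  Inequalities between the V i are proved by induction on the indices,
-- since V (i + 1) is the image of V i under (x , y) ↦ (y + x , (y + x) + y),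
-- which preserves both the quadratic form and the area form.

module Submission where

open import Defs
open import Data.Empty using (⊥-elim)
open import Data.Fin.Base using (zero; suc; toℕ; punchIn; fromℕ<)
open import Data.Fin.Properties using (toℕ-injective; toℕ≤pred[n]; toℕ-fromℕ<; punchInᵢ≢i)
import Data.Integer.Base as ℤ
import Data.Integer.Properties as ℤₚ
open import Data.Nat.Base as ℕ using (ℕ; zero; suc; z≤n; s≤s; _⊔_)
import Data.Nat.Properties as ℕₚ
open import Data.Nat.Tactic.RingSolver using (solve-∀)
open import Data.Product.Base using (_×_; _,_; proj₁; proj₂; ∃-syntax)
open import Data.Rational.Base as ℚ using (ℚ; mkℚ; 0ℚ; 1ℚ; ½; ∣_∣; positive)
import Data.Rational.Properties as ℚₚ
import Data.Rational.Unnormalised.Base as ℚᵘ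
import Data.Rational.Unnormalised.Properties as ℚᵘₚ
open import Data.Rational.Solver using (module +-*-Solver)
open import Data.Sum.Base using (_⊎_; inj₁; inj₂)
open import Data.Vec.Functional using (Vector)
open import Function.Base using (_∘_)
open import Relation.Binary.Definitions using (tri<; tri≈; tri>)
open import Relation.Binary.PropositionalEquality
open import Relation.Nullary using (¬_; yes; no)
open import Relation.Unary using (_∈_)

-- The embedding of ℕ into ℚ

ι : ℕ → ℚ
ι n = ℤ.+ n ℚ./ 1

-- `ι n` is normalised by a gcd that is stuck for variable `n`. Its unnormalised counterpart has the
-- literal denominator 1, so identities there come down to integer arithmetic.
toℚᵘ-ι : ∀ n → ℚ.toℚᵘ (ι n) ℚᵘ.≃ ℚᵘ.mkℚᵘ (ℤ.+ n) 0
toℚᵘ-ι n = ℚₚ.toℚᵘ-fromℚᵘ (ℚᵘ.mkℚᵘ (ℤ.+ n) 0)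

ι-homo-+ : ∀ m n → ι (m ℕ.+ n) ≡ ι m ℚ.+ ι n
ι-homo-+ m n = ℚₚ.toℚᵘ-injective (begin
  ℚ.toℚᵘ (ι (m ℕ.+ n))                          ≈⟨ toℚᵘ-ι (m ℕ.+ n) ⟩
  ℚᵘ.mkℚᵘ (ℤ.+ (m ℕ.+ n)) 0                      ≈⟨ ℚᵘ.*≡* (cong (ℤ._* ℤ.1ℤ)
    (cong₂ ℤ._+_ (sym (ℤₚ.*-identityʳ (ℤ.+ m))) (sym (ℤₚ.*-identityʳ (ℤ.+ n))))) ⟩
  ℚᵘ.mkℚᵘ (ℤ.+ m) 0 ℚᵘ.+ ℚᵘ.mkℚᵘ (ℤ.+ n) 0       ≈⟨ ℚᵘₚ.+-cong (toℚᵘ-ι m) (toℚᵘ-ι n) ⟨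
  ℚ.toℚᵘ (ι m) ℚᵘ.+ ℚ.toℚᵘ (ι n)                ≈⟨ ℚₚ.toℚᵘ-homo-+ (ι m) (ι n) ⟨
  ℚ.toℚᵘ (ι m ℚ.+ ι n)                          ∎)
  where open ℚᵘₚ.≃-Reasoning

ι-homo-* : ∀ m n → ι (m ℕ.* n) ≡ ι m ℚ.* ι n
ι-homo-* m n = ℚₚ.toℚᵘ-injective (begin
  ℚ.toℚᵘ (ι (m ℕ.* n))                          ≈⟨ toℚᵘ-ι (m ℕ.* n) ⟩
  ℚᵘ.mkℚᵘ (ℤ.+ (m ℕ.* n)) 0                      ≈⟨ ℚᵘ.*≡* (cong (ℤ._* ℤ.1ℤ) (ℤₚ.pos-* m n)) ⟩
  ℚᵘ.mkℚᵘ (ℤ.+ m) 0 ℚᵘ.* ℚᵘ.mkℚᵘ (ℤ.+ n) 0       ≈⟨ ℚᵘₚ.*-cong (toℚᵘ-ι m) (toℚᵘ-ι n) ⟨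
  ℚ.toℚᵘ (ι m) ℚᵘ.* ℚ.toℚᵘ (ι n)                ≈⟨ ℚₚ.toℚᵘ-homo-* (ι m) (ι n) ⟨
  ℚ.toℚᵘ (ι m ℚ.* ι n)                          ∎)
  where open ℚᵘₚ.≃-Reasoning

ι-cancel-≤ : ∀ {m n} → ι m ℚ.≤ ι n → m ℕ.≤ n
ι-cancel-≤ {m} {n} ιm≤ιn = ℤₚ.drop‿+≤+ (subst₂ ℤ._≤_
  (ℤₚ.*-identityʳ (ℤ.+ m)) (ℤₚ.*-identityʳ (ℤ.+ n)) (ℚᵘₚ.drop-*≤* (begin
  ℚᵘ.mkℚᵘ (ℤ.+ m) 0  ≃⟨ toℚᵘ-ι m ⟨
  ℚ.toℚᵘ (ι m)      ≤⟨ ℚₚ.toℚᵘ-mono-≤ ιm≤ιn ⟩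
  ℚ.toℚᵘ (ι n)      ≃⟨ toℚᵘ-ι n ⟩
  ℚᵘ.mkℚᵘ (ℤ.+ n) 0  ∎)))
  where open ℚᵘₚ.≤-Reasoning

p≤∣p∣ : ∀ p → p ℚ.≤ ∣ p ∣
p≤∣p∣ (mkℚ (ℤ.+ _) _ _)         = ℚₚ.≤-refl
p≤∣p∣ p@(mkℚ (ℤ.-[1+ _ ]) _ _) = ℚₚ.≤-trans (ℚₚ.nonPositive⁻¹ p) (ℚₚ.0≤∣p∣ p)

-- Half-planes containing a convex hull

-- lim inf s ≥ 0, phrased so that the field has the type 0ℝ ≤ x when s = seq x.
record AsymptoticallyNonNeg (s : ℕ → ℚ) : Set where
  constructor ann
  field
    bound : ∀ ε → 0ℚ ℚ.< ε → ∃[ N ] (∀ n → N ℕ.≤ n → 0ℚ ℚ.- s n ℚ.< ε)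

ann-resp : ∀ {s t} → s ≗ t → AsymptoticallyNonNeg s → AsymptoticallyNonNeg t
ann-resp s≗t (ann 0≤s) = ann λ ε 0<ε →
  let N , p = 0≤s ε 0<ε
  in N , λ n N≤n → subst (λ x → 0ℚ ℚ.- x ℚ.< ε) (s≗t n) (p n N≤n)

ann-0 : AsymptoticallyNonNeg (λ _ → 0ℚ)
ann-0 = ann λ ε 0<ε → 0 , λ _ _ → 0<ε

ann-+ : ∀ {s t} → AsymptoticallyNonNeg s → AsymptoticallyNonNeg t →
        AsymptoticallyNonNeg (λ n → s n ℚ.+ t n)
ann-+ {s} {t} (ann 0≤s) (ann 0≤t) = ann λ ε 0<ε →
  let 0<½ε  = half-pos 0<ε
      M , p = 0≤s (½ ℚ.* ε) 0<½ε
      N , q = 0≤t (½ ℚ.* ε) 0<½ε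
  in M ⊔ N , λ n M⊔N≤n → begin-strict
    0ℚ ℚ.- (s n ℚ.+ t n)           ≡⟨ regroup (s n) (t n) ⟩
    (0ℚ ℚ.- s n) ℚ.+ (0ℚ ℚ.- t n)  <⟨ ℚₚ.+-mono-< (p n (ℕₚ.m⊔n≤o⇒m≤o M N M⊔N≤n))
                                                  (q n (ℕₚ.m⊔n≤o⇒n≤o M N M⊔N≤n)) ⟩
    ½ ℚ.* ε ℚ.+ ½ ℚ.* ε            ≡⟨ ℚₚ.*-distribʳ-+ ε ½ ½ ⟨
    1ℚ ℚ.* ε                       ≡⟨ ℚₚ.*-identityˡ ε ⟩
    ε                              ∎
  where
  open ℚₚ.≤-Reasoning

  half-pos : ∀ {ε} → 0ℚ ℚ.< ε → 0ℚ ℚ.< ½ ℚ.* ε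
  half-pos {ε} 0<ε = ℚₚ.positive⁻¹ (½ ℚ.* ε) {{ℚₚ.pos*pos⇒pos ½ ε {{positive 0<ε}}}}

  regroup : ∀ x y → 0ℚ ℚ.- (x ℚ.+ y) ≡ (0ℚ ℚ.- x) ℚ.+ (0ℚ ℚ.- y)
  regroup = solve 2 (λ x y → con 0ℚ :- (x :+ y) := (con 0ℚ :- x) :+ (con 0ℚ :- y)) refl
    where open +-*-Solver

-- A natural factor is repeated addition, so `ann-+` suffices and no rescaling of ε is needed.
ann-ι* : ∀ m {s} → AsymptoticallyNonNeg s → AsymptoticallyNonNeg (λ n → ι m ℚ.* s n)
ann-ι* zero    {s} 0≤s = ann-resp (λ n → sym (ℚₚ.*-zeroˡ (s n))) ann-0
ann-ι* (suc m) {s} 0≤s = ann-resp step (ann-+ 0≤s (ann-ι* m 0≤s))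
  where
  open ≡-Reasoning

  step : ∀ n → s n ℚ.+ ι m ℚ.* s n ≡ ι (suc m) ℚ.* s n
  step n = begin
    s n ℚ.+ ι m ℚ.* s n          ≡⟨ cong (ℚ._+ ι m ℚ.* s n) (ℚₚ.*-identityˡ (s n)) ⟨
    1ℚ ℚ.* s n ℚ.+ ι m ℚ.* s n   ≡⟨ ℚₚ.*-distribʳ-+ (s n) 1ℚ (ι m) ⟨
    (1ℚ ℚ.+ ι m) ℚ.* s n         ≡⟨ cong (ℚ._* s n) (ι-homo-+ 1 m) ⟨
    ι (suc m) ℚ.* s n            ∎

ann-const⁻ : ∀ {q} → AsymptoticallyNonNeg (λ _ → q) → 0ℚ ℚ.≤ q
ann-const⁻ {q} (ann 0≤q) = ℚₚ.≮⇒≥ λ q<0 →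
  let N , p = 0≤q (0ℚ ℚ.- q)
                  (subst (0ℚ ℚ.<_) (sym (ℚₚ.+-identityˡ (ℚ.- q))) (ℚₚ.neg-antimono-< q<0))
  in ℚₚ.<-irrefl refl (p N ℕₚ.≤-refl)

≈-refl : ∀ {x} → x ≈ x
≈-refl {x} ε 0<ε = 0 , λ n _ →
  subst (λ d → ∣ d ∣ ℚ.< ε) (sym (ℚₚ.+-inverseʳ (seq x n))) 0<ε

≈⇒ann-diff : ∀ {x y} → x ≈ y → AsymptoticallyNonNeg (λ n → seq x n ℚ.- seq y n)
≈⇒ann-diff {x} {y} x≈y = ann λ ε 0<ε →
  let N , p = x≈y ε 0<ε
  in N , λ n N≤n → let d = seq x n ℚ.- seq y n in begin-strict
    0ℚ ℚ.- d   ≡⟨ ℚₚ.+-identityˡ (ℚ.- d) ⟩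
    ℚ.- d      ≤⟨ p≤∣p∣ (ℚ.- d) ⟩
    ∣ ℚ.- d ∣  ≡⟨ ℚₚ.∣-p∣≡∣p∣ d ⟩
    ∣ d ∣      <⟨ p n N≤n ⟩
    ε          ∎
  where open ℚₚ.≤-Reasoning

≈⇒ann-diff′ : ∀ {x y} → x ≈ y → AsymptoticallyNonNeg (λ n → seq y n ℚ.- seq x n)
≈⇒ann-diff′ {x} {y} x≈y = ann λ ε 0<ε →
  let N , p = x≈y ε 0<ε
  in N , λ n N≤n → begin-strict
    0ℚ ℚ.- (seq y n ℚ.- seq x n)  ≡⟨ negate (seq x n) (seq y n) ⟩
    seq x n ℚ.- seq y n           ≤⟨ p≤∣p∣ (seq x n ℚ.- seq y n) ⟩
    ∣ seq x n ℚ.- seq y n ∣       <⟨ p n N≤n ⟩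
    ε                             ∎
  where
  open ℚₚ.≤-Reasoning

  negate : ∀ a b → 0ℚ ℚ.- (b ℚ.- a) ≡ a ℚ.- b
  negate = solve 2 (λ a b → con 0ℚ :- (b :- a) := a :- b) refl
    where open +-*-Solver

-- The factor may have either sign. As the difference tends to 0, both it and its negative are
-- asymptotically nonnegative, so `n` scales the one and `m` the other.
ann-scaled-diff : ∀ m n {x p q} → x ≈ p → p ≈ q →
  AsymptoticallyNonNeg (λ k → (ι n ℚ.- ι m) ℚ.* (seq q k ℚ.- seq x k))
ann-scaled-diff m n {x} {p} {q} x≈p p≈q =
  ann-resp (λ k → regroup (ι m) (ι n) (seq x k) (seq p k) (seq q k))
    (ann-+ (ann-ι* n (ann-+ (≈⇒ann-diff′ {p} {q} p≈q) (≈⇒ann-diff′ {x} {p} x≈p)))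
           (ann-ι* m (ann-+ (≈⇒ann-diff {p} {q} p≈q) (≈⇒ann-diff {x} {p} x≈p))))
  where
  regroup : ∀ μ ν a b c →
    ν ℚ.* ((c ℚ.- b) ℚ.+ (b ℚ.- a)) ℚ.+ μ ℚ.* ((b ℚ.- c) ℚ.+ (a ℚ.- b)) ≡
    (ν ℚ.- μ) ℚ.* (c ℚ.- a)
  regroup = solve 5 (λ μ ν a b c →
    ν :* ((c :- b) :+ (b :- a)) :+ μ :* ((b :- c) :+ (a :- b)) := (ν :- μ) :* (c :- a)) refl
    where open +-*-Solver

-- Affine inequalities on convex combinations

Affine : Set
Affine = ℕ × ℕ × ℕ

infix 8 _at_

-- A half-plane is written as `L at q ≤ R at q` for two such forms, which keeps all coefficients
-- natural; the signed coefficients are the differences.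
_at_ : Affine → ℕ × ℕ → ℕ
(a , b , c) at (x , y) = a ℕ.* x ℕ.+ b ℕ.* y ℕ.+ c

embed : ℕ × ℕ → ℝ²
embed (x , y) = fromℕ x , fromℕ y

ι-at : ∀ a b c x y → ι ((a , b , c) at (x , y)) ≡ ι a ℚ.* ι x ℚ.+ ι b ℚ.* ι y ℚ.+ ι c
ι-at a b c x y = begin
  ι (a ℕ.* x ℕ.+ b ℕ.* y ℕ.+ c)         ≡⟨ ι-homo-+ (a ℕ.* x ℕ.+ b ℕ.* y) c ⟩
  ι (a ℕ.* x ℕ.+ b ℕ.* y) ℚ.+ ι c       ≡⟨ cong (ℚ._+ ι c) (ι-homo-+ (a ℕ.* x) (b ℕ.* y)) ⟩
  ι (a ℕ.* x) ℚ.+ ι (b ℕ.* y) ℚ.+ ι c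
    ≡⟨ cong (ℚ._+ ι c) (cong₂ ℚ._+_ (ι-homo-* a x) (ι-homo-* b y)) ⟩
  ι a ℚ.* ι x ℚ.+ ι b ℚ.* ι y ℚ.+ ι c   ∎
  where open ≡-Reasoning

ι-diff : ∀ a b c a′ b′ c′ x y d →
  (a , b , c) at (x , y) ℕ.+ d ≡ (a′ , b′ , c′) at (x , y) →
  (ι a′ ℚ.- ι a) ℚ.* ι x ℚ.+ (ι b′ ℚ.- ι b) ℚ.* ι y ℚ.+ (ι c′ ℚ.- ι c) ≡ ι d
ι-diff a b c a′ b′ c′ x y d L+d≡R = begin
  (ι a′ ℚ.- ι a) ℚ.* ι x ℚ.+ (ι b′ ℚ.- ι b) ℚ.* ι y ℚ.+ (ι c′ ℚ.- ι c)
    ≡⟨ regroup (ι a) (ι b) (ι c) (ι a′) (ι b′) (ι c′) (ι x) (ι y) ⟩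
  (ι a′ ℚ.* ι x ℚ.+ ι b′ ℚ.* ι y ℚ.+ ι c′) ℚ.- l
    ≡⟨ cong (ℚ._- l) (ι-at a′ b′ c′ x y) ⟨
  ι ((a′ , b′ , c′) at (x , y)) ℚ.- l
    ≡⟨ cong (λ r → ι r ℚ.- l) L+d≡R ⟨
  ι ((a , b , c) at (x , y) ℕ.+ d) ℚ.- l
    ≡⟨ cong (ℚ._- l) (ι-homo-+ ((a , b , c) at (x , y)) d) ⟩
  (ι ((a , b , c) at (x , y)) ℚ.+ ι d) ℚ.- l
    ≡⟨ cong (λ r → (r ℚ.+ ι d) ℚ.- l) (ι-at a b c x y) ⟩
  (l ℚ.+ ι d) ℚ.- l
    ≡⟨ cancel l (ι d) ⟩
  ι d ∎
  where
  open ≡-Reasoning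
  open +-*-Solver

  l = ι a ℚ.* ι x ℚ.+ ι b ℚ.* ι y ℚ.+ ι c

  regroup : ∀ a b c a′ b′ c′ x y →
    (a′ ℚ.- a) ℚ.* x ℚ.+ (b′ ℚ.- b) ℚ.* y ℚ.+ (c′ ℚ.- c) ≡
    (a′ ℚ.* x ℚ.+ b′ ℚ.* y ℚ.+ c′) ℚ.- (a ℚ.* x ℚ.+ b ℚ.* y ℚ.+ c)
  regroup = solve 8 (λ a b c a′ b′ c′ x y →
    (a′ :- a) :* x :+ (b′ :- b) :* y :+ (c′ :- c) :=
    (a′ :* x :+ b′ :* y :+ c′) :- (a :* x :+ b :* y :+ c)) refl

  cancel : ∀ l d → (l ℚ.+ d) ℚ.- l ≡ d
  cancel = solve 2 (λ l d → (l :+ d) :- l := d) refl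

-- The expression is the sum of the weights times the slacks of the inequality at the points. It is
-- treated homogeneously, with `∑ w` multiplying the constant term; normalisation comes later.
conv-halfPlane-seq : ∀ a b c a′ b′ c′ {n} (v : Vector (ℕ × ℕ) n) (w : Vector ℝ n) →
  (∀ i → 0ℝ ≤ w i) →
  (∀ i → (a , b , c) at v i ℕ.≤ (a′ , b′ , c′) at v i) →
  AsymptoticallyNonNeg (λ k →
    (ι a′ ℚ.- ι a) ℚ.* seq (∑ (λ i → w i * fromℕ (proj₁ (v i)))) k ℚ.+
    (ι b′ ℚ.- ι b) ℚ.* seq (∑ (λ i → w i * fromℕ (proj₂ (v i)))) k ℚ.+
    (ι c′ ℚ.- ι c) ℚ.* seq (∑ w) k)
conv-halfPlane-seq a b c a′ b′ c′ {zero} v w 0≤w L≤R =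
  ann-resp (λ _ → vanish (ι a′ ℚ.- ι a) (ι b′ ℚ.- ι b) (ι c′ ℚ.- ι c)) ann-0
  where
  vanish : ∀ α β γ → 0ℚ ≡ α ℚ.* 0ℚ ℚ.+ β ℚ.* 0ℚ ℚ.+ γ ℚ.* 0ℚ
  vanish = solve 3 (λ α β γ → con 0ℚ := α :* con 0ℚ :+ β :* con 0ℚ :+ γ :* con 0ℚ) refl
    where open +-*-Solver
conv-halfPlane-seq a b c a′ b′ c′ {suc n} v w 0≤w L≤R
  -- The slack `d` is a natural number, so `ann-ι*` applies to its product with the weight.
  with ℕₚ.m≤n⇒∃[o]m+o≡n (L≤R zero)
... | d , L+d≡R =
  ann-resp
    (λ k → trans
      (cong (λ q → q ℚ.* seq (w zero) k ℚ.+ _)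
            (sym (ι-diff a b c a′ b′ c′ (proj₁ (v zero)) (proj₂ (v zero)) d L+d≡R)))
      (regroup (ι a′ ℚ.- ι a) (ι b′ ℚ.- ι b) (ι c′ ℚ.- ι c)
        (ι (proj₁ (v zero))) (ι (proj₂ (v zero))) (seq (w zero) k) _ _ _))
    (ann-+ (ann-ι* d (ann (0≤w zero)))
           (conv-halfPlane-seq a b c a′ b′ c′ (v ∘ suc) (w ∘ suc) (0≤w ∘ suc) (L≤R ∘ suc)))
  where
  regroup : ∀ α β γ x y u X Y U →
    (α ℚ.* x ℚ.+ β ℚ.* y ℚ.+ γ) ℚ.* u ℚ.+ (α ℚ.* X ℚ.+ β ℚ.* Y ℚ.+ γ ℚ.* U) ≡
    α ℚ.* (u ℚ.* x ℚ.+ X) ℚ.+ β ℚ.* (u ℚ.* y ℚ.+ Y) ℚ.+ γ ℚ.* (u ℚ.+ U)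
  regroup = solve 9 (λ α β γ x y u X Y U →
    (α :* x :+ β :* y :+ γ) :* u :+ (α :* X :+ β :* Y :+ γ :* U) :=
    α :* (u :* x :+ X) :+ β :* (u :* y :+ Y) :+ γ :* (u :+ U)) refl
    where open +-*-Solver

-- The limit of the weighted slacks is a constant, so asymptotic nonnegativity becomes an inequality
-- in ℕ. The point `p` is kept apart from `embed q` because members of the set are given only up to
-- `≈`.
conv-halfPlane : ∀ (L R : Affine) {n} (v : Vector (ℕ × ℕ) n) {p q} →
  p ∈ conv (embed ∘ v) → p ≈² embed q →
  (∀ i → L at v i ℕ.≤ R at v i) → L at q ℕ.≤ R at q
conv-halfPlane L@(a , b , c) R@(a′ , b′ , c′) v {px , py} {q@(x , y)}
  (w , 0≤w , ∑w≈1 , ∑x≈px , ∑y≈py) (px≈x , py≈y) L≤R = ι-cancel-≤ (begin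
    ι (L at q)                            ≡⟨ ι-at a b c x y ⟩
    l                                     ≡⟨ ℚₚ.+-identityˡ l ⟨
    0ℚ ℚ.+ l                              ≤⟨ ℚₚ.+-monoˡ-≤ l (ann-const⁻ 0≤R-L) ⟩
    (α ℚ.* ι x ℚ.+ β ℚ.* ι y ℚ.+ γ) ℚ.+ l
      ≡⟨ cancel (ι a) (ι b) (ι c) (ι a′) (ι b′) (ι c′) (ι x) (ι y) ⟩
    ι a′ ℚ.* ι x ℚ.+ ι b′ ℚ.* ι y ℚ.+ ι c′ ≡⟨ ι-at a′ b′ c′ x y ⟨
    ι (R at q)                            ∎)
  where
  open ℚₚ.≤-Reasoning
  open +-*-Solver

  α = ι a′ ℚ.- ι a
  β = ι b′ ℚ.- ι b
  γ = ι c′ ℚ.- ι c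
  l = ι a ℚ.* ι x ℚ.+ ι b ℚ.* ι y ℚ.+ ι c

  X = ∑ (λ i → w i * fromℕ (proj₁ (v i)))
  Y = ∑ (λ i → w i * fromℕ (proj₂ (v i)))

  regroup : ∀ α β γ x y X Y U →
    (α ℚ.* X ℚ.+ β ℚ.* Y ℚ.+ γ ℚ.* U) ℚ.+
      (α ℚ.* (x ℚ.- X) ℚ.+ (β ℚ.* (y ℚ.- Y) ℚ.+ γ ℚ.* (1ℚ ℚ.- U))) ≡
    α ℚ.* x ℚ.+ β ℚ.* y ℚ.+ γ
  regroup = solve 8 (λ α β γ x y X Y U →
    (α :* X :+ β :* Y :+ γ :* U) :+
      (α :* (x :- X) :+ (β :* (y :- Y) :+ γ :* (con 1ℚ :- U))) :=
    α :* x :+ β :* y :+ γ) refl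

  cancel : ∀ a b c a′ b′ c′ x y →
    ((a′ ℚ.- a) ℚ.* x ℚ.+ (b′ ℚ.- b) ℚ.* y ℚ.+ (c′ ℚ.- c)) ℚ.+
      (a ℚ.* x ℚ.+ b ℚ.* y ℚ.+ c) ≡
    a′ ℚ.* x ℚ.+ b′ ℚ.* y ℚ.+ c′
  cancel = solve 8 (λ a b c a′ b′ c′ x y →
    ((a′ :- a) :* x :+ (b′ :- b) :* y :+ (c′ :- c)) :+ (a :* x :+ b :* y :+ c) :=
    a′ :* x :+ b′ :* y :+ c′) refl

  0≤R-L : AsymptoticallyNonNeg (λ _ → α ℚ.* ι x ℚ.+ β ℚ.* ι y ℚ.+ γ)
  -- Each correction term replaces one sum by its limit: `X` by `ι x`, `Y` by `ι y`, `∑ w` by 1.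
  0≤R-L = ann-resp
    (λ k → regroup α β γ (ι x) (ι y) (seq X k) (seq Y k) (seq (∑ w) k))
    (ann-+ (conv-halfPlane-seq a b c a′ b′ c′ v w 0≤w L≤R)
      (ann-+ (ann-scaled-diff a a′ {X} {px} {fromℕ x} ∑x≈px px≈x)
        (ann-+ (ann-scaled-diff b b′ {Y} {py} {fromℕ y} ∑y≈py py≈y)
               (ann-scaled-diff c c′ {∑ w} {1ℝ} {1ℝ} ∑w≈1 (≈-refl {1ℝ})))))

-- Fibonacci numbers

0<F : ∀ n → 0 ℕ.< F n
0<F 0             = s≤s z≤n
0<F 1             = s≤s z≤n
0<F (suc (suc n)) = ℕₚ.≤-trans (0<F (suc n)) (ℕₚ.m≤m+n (F (suc n)) (F n))

F-step : ∀ n → F n ℕ.≤ F (suc n)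
F-step zero    = ℕₚ.≤-refl
F-step (suc n) = ℕₚ.m≤m+n (F (suc n)) (F n)

F-mono : ∀ {m n} → m ℕ.≤ n → F m ℕ.≤ F n
F-mono = go ∘ ℕₚ.≤⇒≤′
  where
  go : ∀ {m n} → m ℕ.≤′ n → F m ℕ.≤ F n
  go ℕ.≤′-refl                   = ℕₚ.≤-refl
  go {n = suc n} (ℕ.≤′-step m≤n) = ℕₚ.≤-trans (go m≤n) (F-step n)

-- Points on the hyperbola: tangents and slopes

Fpair : ℕ → ℕ × ℕ
Fpair n = F n , F (suc n)

-- With `i * 2` rather than `2 * i`, `V (suc i)` unfolds to the linear image of `V i` by
-- computation.
V : ℕ → ℕ × ℕ
V i = Fpair (i ℕ.* 2)

-- The equation says R′ − L′ = R − L without subtraction.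
≤-transfer : ∀ {l r l′ r′} → l′ ℕ.+ r ≡ r′ ℕ.+ l → l ℕ.≤ r → l′ ℕ.≤ r′
≤-transfer {l} {r} {l′} {r′} eq l≤r =
  ℕₚ.+-cancelʳ-≤ r l′ r′ (subst (ℕ._≤ r′ ℕ.+ r) (sym eq) (ℕₚ.+-monoʳ-≤ r′ l≤r))

-- With B the polar form of x² + xy − y², so that B(p , p) = 2 for p on the
-- hyperbola, tangentˡ k p ≤ tangentʳ p is the half-plane B(p , _) ≥ k.
tangentˡ : ℕ → ℕ × ℕ → Affine
tangentˡ k (x , y) = 0 , 2 ℕ.* y , k

tangentʳ : ℕ × ℕ → Affine
tangentʳ (x , y) = 2 ℕ.* x ℕ.+ y , x , 0

-- Shifting both indices preserves B, so one index may be taken to be 0. Against `V 0` the form is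
-- 3u - w, which at the image of (x , y) equals 2x + y ≥ 3. Since B is 2 on the diagonal, the
-- threshold 3 cuts off `V i` alone.
V-separated : ∀ i j → i ≢ j → tangentˡ 3 (V i) at V j ℕ.≤ tangentʳ (V i) at V j
V-separated zero zero 0≢0 = ⊥-elim (0≢0 refl)
V-separated zero (suc j) _ =
  ≤-transfer (regroup (F (j ℕ.* 2)) (F (suc (j ℕ.* 2))))
    (ℕₚ.+-mono-≤ (0<F (suc (j ℕ.* 2))) (ℕₚ.+-mono-≤ (0<F (j ℕ.* 2)) (0<F (j ℕ.* 2))))
  where
  regroup : ∀ x y →
    (2 ℕ.* ((y ℕ.+ x) ℕ.+ y) ℕ.+ 3) ℕ.+ (y ℕ.+ (x ℕ.+ x)) ≡
    (3 ℕ.* (y ℕ.+ x) ℕ.+ 1 ℕ.* ((y ℕ.+ x) ℕ.+ y) ℕ.+ 0) ℕ.+ 3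
  regroup = solve-∀
V-separated (suc i) zero _ =
  ≤-transfer (regroup (F (i ℕ.* 2)) (F (suc (i ℕ.* 2))))
    (ℕₚ.+-mono-≤ (0<F (suc (i ℕ.* 2))) (ℕₚ.+-mono-≤ (0<F (i ℕ.* 2)) (0<F (i ℕ.* 2))))
  where
  regroup : ∀ x y →
    (2 ℕ.* ((y ℕ.+ x) ℕ.+ y) ℕ.* 1 ℕ.+ 3) ℕ.+ (y ℕ.+ (x ℕ.+ x)) ≡
    ((2 ℕ.* (y ℕ.+ x) ℕ.+ ((y ℕ.+ x) ℕ.+ y)) ℕ.* 1 ℕ.+ (y ℕ.+ x) ℕ.* 1 ℕ.+ 0) ℕ.+ 3
  regroup = solve-∀
V-separated (suc i) (suc j) i≢j =
  ≤-transfer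
    (regroup (F (i ℕ.* 2)) (F (suc (i ℕ.* 2))) (F (j ℕ.* 2)) (F (suc (j ℕ.* 2))))
    (V-separated i j (i≢j ∘ cong suc))
  where
  regroup : ∀ x y u w →
    (2 ℕ.* ((y ℕ.+ x) ℕ.+ y) ℕ.* ((w ℕ.+ u) ℕ.+ w) ℕ.+ 3) ℕ.+
      ((2 ℕ.* x ℕ.+ y) ℕ.* u ℕ.+ x ℕ.* w ℕ.+ 0) ≡
    ((2 ℕ.* (y ℕ.+ x) ℕ.+ ((y ℕ.+ x) ℕ.+ y)) ℕ.* (w ℕ.+ u) ℕ.+
      (y ℕ.+ x) ℕ.* ((w ℕ.+ u) ℕ.+ w) ℕ.+ 0) ℕ.+
      (2 ℕ.* y ℕ.* w ℕ.+ 3)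
  regroup = solve-∀

V-on-tangent : ∀ i → tangentʳ (V i) at V i ℕ.≤ tangentˡ 2 (V i) at V i
V-on-tangent zero    = ℕₚ.≤-refl
V-on-tangent (suc i) =
  ≤-transfer (regroup (F (i ℕ.* 2)) (F (suc (i ℕ.* 2)))) (V-on-tangent i)
  where
  regroup : ∀ x y →
    ((2 ℕ.* (y ℕ.+ x) ℕ.+ ((y ℕ.+ x) ℕ.+ y)) ℕ.* (y ℕ.+ x) ℕ.+
      (y ℕ.+ x) ℕ.* ((y ℕ.+ x) ℕ.+ y) ℕ.+ 0) ℕ.+
      (2 ℕ.* y ℕ.* y ℕ.+ 2) ≡
    (2 ℕ.* ((y ℕ.+ x) ℕ.+ y) ℕ.* ((y ℕ.+ x) ℕ.+ y) ℕ.+ 2) ℕ.+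
      ((2 ℕ.* x ℕ.+ y) ℕ.* x ℕ.+ x ℕ.* y ℕ.+ 0)
  regroup = solve-∀

V-not-separated : ∀ i → ¬ (tangentˡ 3 (V i) at V i ℕ.≤ tangentʳ (V i) at V i)
V-not-separated i le = ℕₚ.1+n≰n
  (subst (ℕ._≤ tangentˡ 2 (V i) at V i)
         (ℕₚ.+-suc (2 ℕ.* F (suc (i ℕ.* 2)) ℕ.* F (suc (i ℕ.* 2))) 2)
         (ℕₚ.≤-trans le (V-on-tangent i)))

-- The area form of the two points is invariant under shifting both indices. Hence the line from the
-- origin through the last vertex bounds the hull from above.
V-slope-mono : ∀ {i j} → i ℕ.≤ j →
  proj₁ (V j) ℕ.* proj₂ (V i) ℕ.≤ proj₂ (V j) ℕ.* proj₁ (V i)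
V-slope-mono {j = j} z≤n = ℕₚ.*-monoˡ-≤ 1 (F-step (j ℕ.* 2))
V-slope-mono {suc i} {suc j} (s≤s i≤j) =
  ≤-transfer
    (regroup (F (i ℕ.* 2)) (F (suc (i ℕ.* 2))) (F (j ℕ.* 2)) (F (suc (j ℕ.* 2))))
    (V-slope-mono i≤j)
  where
  regroup : ∀ x y u w →
    (w ℕ.+ u) ℕ.* ((y ℕ.+ x) ℕ.+ y) ℕ.+ w ℕ.* x ≡
    ((w ℕ.+ u) ℕ.+ w) ℕ.* (y ℕ.+ x) ℕ.+ u ℕ.* y
  regroup = solve-∀

V₂<2V₁ : ∀ i → proj₂ (V i) ℕ.< proj₁ (V i) ℕ.+ proj₁ (V i)
V₂<2V₁ zero    = ℕₚ.≤-refl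
V₂<2V₁ (suc i) =
  ≤-transfer (regroup (F (i ℕ.* 2)) (F (suc (i ℕ.* 2)))) (0<F (i ℕ.* 2))
  where
  regroup : ∀ x y →
    suc ((y ℕ.+ x) ℕ.+ y) ℕ.+ x ≡ ((y ℕ.+ x) ℕ.+ (y ℕ.+ x)) ℕ.+ 1
  regroup = solve-∀

-- Slopes of the `V i` lie below φ, those of the odd pairs above it. The common shift preserves the
-- area form here too, leaving the slope 2 of the first odd pair and the slope 1 of `V 0` as base
-- cases.
V-slope<odd-slope : ∀ i j →
  proj₂ (V i) ℕ.* F (suc (j ℕ.* 2)) ℕ.< proj₁ (V i) ℕ.* F (2 ℕ.+ j ℕ.* 2)
V-slope<odd-slope i zero = subst₂ ℕ._<_
  (sym (ℕₚ.*-identityʳ _)) (double (proj₁ (V i))) (V₂<2V₁ i)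
  where
  double : ∀ x → x ℕ.+ x ≡ x ℕ.* 2
  double = solve-∀
V-slope<odd-slope zero (suc j) = ℕₚ.*-monoʳ-< 1 (ℕₚ.m<m+n _ (0<F (2 ℕ.+ j ℕ.* 2)))
V-slope<odd-slope (suc i) (suc j) =
  ≤-transfer
    (regroup (F (i ℕ.* 2)) (F (suc (i ℕ.* 2))) (F (suc (j ℕ.* 2))) (F (2 ℕ.+ j ℕ.* 2)))
    (V-slope<odd-slope i j)
  where
  regroup : ∀ x y u w →
    suc (((y ℕ.+ x) ℕ.+ y) ℕ.* (w ℕ.+ u)) ℕ.+ x ℕ.* w ≡
    (y ℕ.+ x) ℕ.* ((w ℕ.+ u) ℕ.+ w) ℕ.+ suc (y ℕ.* u)
  regroup = solve-∀

-- Two index steps at least double a Fibonacci number, while the slope of `V i` is below 2.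
V-slope<steep : ∀ i {a b} → 2 ℕ.+ a ℕ.≤ b → proj₂ (V i) ℕ.* F a ℕ.< proj₁ (V i) ℕ.* F b
V-slope<steep i {a} {b} 2+a≤b = begin-strict
  y ℕ.* F a              <⟨ ℕₚ.*-monoˡ-< (F a) {{ℕ.>-nonZero (0<F a)}} (V₂<2V₁ i) ⟩
  (x ℕ.+ x) ℕ.* F a      ≡⟨ regroup x (F a) ⟩
  x ℕ.* (F a ℕ.+ F a)    ≤⟨ ℕₚ.*-monoʳ-≤ x (ℕₚ.+-monoˡ-≤ (F a) (F-step a)) ⟩
  x ℕ.* F (2 ℕ.+ a)      ≤⟨ ℕₚ.*-monoʳ-≤ x (F-mono 2+a≤b) ⟩
  x ℕ.* F b              ∎
  where
  open ℕₚ.≤-Reasoning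
  x = proj₁ (V i)
  y = proj₂ (V i)

  regroup : ∀ x z → (x ℕ.+ x) ℕ.* z ≡ x ℕ.* (z ℕ.+ z)
  regroup = solve-∀

V₁-mono : ∀ {i j} → i ℕ.≤ j → proj₁ (V i) ℕ.≤ proj₁ (V j)
V₁-mono i≤j = F-mono (ℕₚ.*-monoˡ-≤ 2 i≤j)

V₁-cancel-≤ : ∀ {i j} → proj₁ (V i) ℕ.≤ proj₁ (V j) → i ℕ.≤ j
V₁-cancel-≤ {i} {j} le with i ℕₚ.≤? j
... | yes i≤j = i≤j
-- Strictness comes from a step of two indices; a single step may be an equality, as `F 0` and `F 1`
-- agree.
... | no  i≰j = ⊥-elim (ℕₚ.<⇒≱
  (ℕₚ.<-≤-trans (ℕₚ.m<n+m (F (j ℕ.* 2)) (0<F (suc (j ℕ.* 2)))) (V₁-mono (ℕₚ.≰⇒> i≰j))) le)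

-- A line through (1 , 1) slightly steeper than the diagonal.
V-above-diagonal : ∀ {i j} → i ℕ.≤ j →
  let x = proj₁ (V i) ; y = proj₂ (V i) ; k = proj₁ (V j) in
  k ℕ.* x ℕ.+ x ℕ.≤ k ℕ.* y ℕ.+ 1
V-above-diagonal {zero}  {j} _   = ℕₚ.≤-refl
V-above-diagonal {suc i} {j} i≤j = begin
  -- Past `V 0` the ordinate exceeds the abscissa by at least 1; multiplied by `k`, this gain
  -- absorbs `x`, since `x ≤ k`.
  k ℕ.* x ℕ.+ x            ≤⟨ ℕₚ.+-monoʳ-≤ (k ℕ.* x) (V₁-mono {suc i} {j} i≤j) ⟩
  k ℕ.* x ℕ.+ k            ≡⟨ regroup k x ⟩
  k ℕ.* (x ℕ.+ 1)          ≤⟨ ℕₚ.*-monoʳ-≤ k (ℕₚ.+-monoʳ-≤ x (0<F (suc (i ℕ.* 2)))) ⟩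
  k ℕ.* proj₂ (V (suc i))  ≤⟨ ℕₚ.m≤m+n _ 1 ⟩
  k ℕ.* proj₂ (V (suc i)) ℕ.+ 1 ∎
  where
  open ℕₚ.≤-Reasoning
  k = proj₁ (V j)
  x = proj₁ (V (suc i))

  regroup : ∀ k x → k ℕ.* x ℕ.+ k ≡ k ℕ.* (x ℕ.+ 1)
  regroup = solve-∀

-- Fibonacci pairs inside the hull

even⊎odd : ∀ n → (∃[ i ] n ≡ i ℕ.* 2) ⊎ (∃[ i ] n ≡ suc (i ℕ.* 2))
even⊎odd zero          = inj₁ (0 , refl)
even⊎odd (suc zero)    = inj₂ (0 , refl)
even⊎odd (suc (suc n)) with even⊎odd n
... | inj₁ (i , refl) = inj₁ (suc i , refl)
... | inj₂ (i , refl) = inj₂ (suc i , refl)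

-- Three half-planes around the hull already exclude every other pair. The conclusion equates
-- values, not indices, because the value 1 occurs at both 0 and 1.
Fibonacci-in-hull : ∀ K a b →
  F a ℕ.≤ proj₁ (V K) →
  proj₁ (V K) ℕ.* F a ℕ.+ F a ℕ.≤ proj₁ (V K) ℕ.* F b ℕ.+ 1 →
  proj₁ (V K) ℕ.* F b ℕ.≤ proj₂ (V K) ℕ.* F a →
  ∃[ i ] i ℕ.≤ K × (F a , F b) ≡ V i
Fibonacci-in-hull K a b Fa≤xK above below with ℕₚ.<-cmp b (suc a)
-- Here `F b ≤ F a`, so the `xK` multiples in `above` cancel to `F a ≤ 1`, leaving only (1 , 1).
... | tri< (s≤s b≤a) _ _ = 0 , z≤n , cong₂ _,_ Fa≡1 Fb≡1
  where
  Fa≤1 : F a ℕ.≤ 1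
  Fa≤1 = ℕₚ.+-cancelˡ-≤ (proj₁ (V K) ℕ.* F a) (F a) 1
    (ℕₚ.≤-trans above (ℕₚ.+-monoˡ-≤ 1 (ℕₚ.*-monoʳ-≤ (proj₁ (V K)) (F-mono b≤a))))
  Fa≡1 = ℕₚ.≤-antisym Fa≤1 (0<F a)
  Fb≡1 = ℕₚ.≤-antisym (ℕₚ.≤-trans (F-mono b≤a) Fa≤1) (0<F b)
... | tri> _ _ 2+a≤b = ⊥-elim (ℕₚ.<⇒≱ (V-slope<steep K 2+a≤b) below)
... | tri≈ _ refl _ with even⊎odd a
...   | inj₁ (i , refl) = i , V₁-cancel-≤ {i} {K} Fa≤xK , refl
...   | inj₂ (i , refl) = ⊥-elim (ℕₚ.<⇒≱ (V-slope<odd-slope K i) below)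

-- The empty polygons

module _ (m : ℕ) where

  -- The index of the last of the `3 + m` vertices `V 0`, ..., `V K`.
  K = 2 ℕ.+ m

  vertices : Vector (ℕ × ℕ) (3 ℕ.+ m)
  vertices = V ∘ toℕ

  Fibonacci-polygon : ConvexPolygon m
  Fibonacci-polygon = record
    { vertex         = embed ∘ vertices
    ; convexPosition = λ i vᵢ∈conv → V-not-separated (toℕ i)
        (conv-halfPlane (tangentˡ 3 (vertices i)) (tangentʳ (vertices i))
          -- `removeAt` unfolds to precomposition with `punchIn i`, which never takes the value `i`.
          (vertices ∘ punchIn i) {embed (vertices i)} vᵢ∈conv
          (≈-refl {fromℕ (proj₁ (vertices i))} , ≈-refl {fromℕ (proj₂ (vertices i))})
          λ j → V-separated (toℕ i) (toℕ (punchIn i j))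
                  (punchInᵢ≢i i j ∘ sym ∘ toℕ-injective))
    }

  Fibonacci-polygon-empty : IsEmptyIn (FibonacciSet ²) Fibonacci-polygon
  Fibonacci-polygon-empty = record
    { vertices∈S = λ i → (toℕ i ℕ.* 2       , ≈-refl {fromℕ (proj₁ (vertices i))})
                       , (suc (toℕ i ℕ.* 2) , ≈-refl {fromℕ (proj₂ (vertices i))})
    ; empty      = empty′
    }
    where
    xK = proj₁ (V K)
    yK = proj₂ (V K)

    empty′ : ∀ p → p ∈ FibonacciSet ² → p ∈ region Fibonacci-polygon →
             ∃[ i ] p ≈² vertex Fibonacci-polygon i
    empty′ p ((a , x≈Fa) , (b , y≈Fb)) p∈P =
      let i , i≤K , eq = Fibonacci-in-hull K a b left above below
      in fromℕ< (s≤s i≤K) ,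
         subst (λ q → p ≈² embed q)
               (trans eq (cong V (sym (toℕ-fromℕ< (s≤s i≤K))))) (x≈Fa , y≈Fb)
      where
      halfPlane : ∀ L R → (∀ {i} → i ℕ.≤ K → L at V i ℕ.≤ R at V i) →
                  L at (F a , F b) ℕ.≤ R at (F a , F b)
      halfPlane L R L≤R = conv-halfPlane L R vertices {p} p∈P (x≈Fa , y≈Fb)
        (λ i → L≤R (toℕ≤pred[n] i))

      left : F a ℕ.≤ xK
      left = subst₂ ℕ._≤_ (l (F a)) refl
        (halfPlane (1 , 0 , 0) (0 , 0 , xK) λ {i} i≤K →
          subst₂ ℕ._≤_ (sym (l (F (i ℕ.* 2)))) refl (V₁-mono i≤K))
        where
        l : ∀ x → 1 ℕ.* x ℕ.+ 0 ℕ.+ 0 ≡ x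
        l = solve-∀

      above : xK ℕ.* F a ℕ.+ F a ℕ.≤ xK ℕ.* F b ℕ.+ 1
      above = subst (ℕ._≤ xK ℕ.* F b ℕ.+ 1) (l xK (F a))
        (halfPlane (xK ℕ.+ 1 , 0 , 0) (0 , xK , 1) λ {i} i≤K →
          subst (ℕ._≤ xK ℕ.* F (suc (i ℕ.* 2)) ℕ.+ 1) (sym (l xK (F (i ℕ.* 2))))
            (V-above-diagonal {i} {K} i≤K))
        where
        l : ∀ k x → (k ℕ.+ 1) ℕ.* x ℕ.+ 0 ℕ.+ 0 ≡ k ℕ.* x ℕ.+ x
        l = solve-∀

      below : xK ℕ.* F b ℕ.≤ yK ℕ.* F a
      below = subst₂ ℕ._≤_ (l xK (F b)) (r yK (F a))
        (halfPlane (0 , xK , 0) (yK , 0 , 0) λ {i} i≤K →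
          subst₂ ℕ._≤_ (sym (l xK (F (suc (i ℕ.* 2))))) (sym (r yK (F (i ℕ.* 2))))
            (V-slope-mono i≤K))
        where
        l : ∀ k y → k ℕ.* y ℕ.+ 0 ≡ k ℕ.* y
        l = solve-∀
        r : ∀ k x → k ℕ.* x ℕ.+ 0 ℕ.+ 0 ≡ k ℕ.* x
        r = solve-∀

proposition5 : h (FibonacciSet ²) ≡∞
proposition5 k = k , ℕₚ.m≤n+m k 3 , Fibonacci-polygon k , Fibonacci-polygon-empty k
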